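{- Let $\hat\pi:[n]\to[m]$ be a (possibly infeasible) predicted assignment for an instance of Restricted Assignment, and let $\hat\sigma=\mathsf{Project}(\hat\pi)$. Then $$C_{\max}(\hat\sigma)\le \mathrm{OPT}+\mathcal{E}.$$
   Context: Restricted Assignment: there are $n$ jobs and $m$ machines. Each job $j\in[n]$ has an integer processing time $p_j\in\mathbb{Z}_{\ge 1}$ and a nonempty set $\Gamma(j)\subseteq[m]$ of eligible machines. A schedule $\sigma:[n]\to[m]$ is feasible if $\sigma(j)\in\Gamma(j)$ for all $j$. Write $L_i(\sigma)=\sum_{j:\sigma(j)=i}p_j$, $C_{\max}(\sigma)=\max_{i\in[m]}L_i(\sigma)$, and $\mathrm{OPT}=\min\{C_{\max}(\sigma):\sigma\text{ feasible}\}$. For a feasible schedule $\sigma$ and any map $\tau:[n]\to[m]$, $\mathrm{move}(\sigma,\tau)=\sum_{j:\sigma(j)\ne\tau(j)}p_j$. The prediction error is $\mathcal{E}=\min\{\mathrm{move}(\sigma^*,\hat\pi):\sigma^*\text{ feasible and }C_{\max}(\sigma^*)=\mathrm{OPT}\}$. $\mathsf{Project}(\hat\pi)$: process the jobs one by one in a fixed arbitrary order; if $\hat\pi(j)\in\Gamma(j)$, set $\hat\sigma(j)=\hat\pi(j)$; otherwise assign $j$ to a currently least-loaded machine of $\Gamma(j)$ (ties broken arbitrarily). The output $\hat\sigma$ is a feasible schedule. -}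

module Defs where

open import Data.Fin.Base using (Fin; finToFun; funToFin)
open import Data.Fin.Properties using (_≟_; all?; finToFun-funToFin)
open import Data.Fin.Subset using (Subset; Nonempty; _∈_; _∉_)
open import Data.Fin.Subset.Properties using (_∈?_)
open import Data.List.Base using (List; []; _∷_; _∷ʳ_; map; filter; allFin)
open import Data.List.Extrema.Nat using (argmin; argmin-all; f[argmin]≤f[xs]; max)
open import Data.List.Membership.Propositional.Properties
  using (∈-allFin; ∈-filter⁺; ∈-map⁺)
open import Data.List.Properties using (filter-≐; map-cong)
open import Data.List.Relation.Binary.Permutation.Propositional using (_↭_)
open import Data.List.Relation.Unary.All using (lookup)
open import Data.List.Relation.Unary.All.Properties using (all-filter)
open import Data.Nat.Base using (ℕ; _≤_)
open import Data.Nat.ListAction using (sum)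
open import Data.Nat.Properties using () renaming (_≟_ to _≟ℕ_)
open import Data.Product.Base using (∃; _×_; _,_; proj₁; proj₂)
open import Relation.Binary.Core using (_Preserves_⟶_)
open import Relation.Binary.Definitions using (_Respects_)
open import Relation.Binary.PropositionalEquality
  using (_≡_; _≗_; refl; sym; trans; cong; subst)
open import Relation.Nullary.Decidable using (¬?; _×-dec_)
open import Relation.Unary using (Pred; Decidable)
open import Level using (0ℓ)

record Instance (n m : ℕ) : Set where
  field
    p          : Fin n → ℕ
    p≥1        : ∀ j → 1 ≤ p j
    Γ          : Fin n → Subset m
    Γ-nonempty : ∀ j → Nonempty (Γ j)

Schedule : ℕ → ℕ → Set
Schedule n m = Fin n → Fin m

record Minimum {n m} (P : Pred (Schedule n m) 0ℓ) (f : Schedule n m → ℕ) : Set where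
  field
    minimizer : Schedule n m
    member    : P minimizer
    least     : ∀ τ → P τ → f minimizer ≤ f τ

  value : ℕ
  value = f minimizer

-- Without function extensionality, the enumeration `finToFun` reaches every
-- schedule only up to _≗_, so P and f have to respect pointwise equality.
minimum : ∀ {n m} {P : Pred (Schedule n m) 0ℓ} {f : Schedule n m → ℕ} →
          Decidable P → P Respects _≗_ → f Preserves _≗_ ⟶ _≡_ →
          ∃ P → Minimum P f
minimum {n} {m} {P} {f} P? P-resp f-cong (σ₀ , Pσ₀) = record
  { minimizer = argmin f σ₀ σs
  ; member    = argmin-all f Pσ₀ (all-filter P? all)
  ; least     = λ τ Pτ → subst (f (argmin f σ₀ σs) ≤_) (f-cong (finToFun-funToFin τ))
      (lookup (f[argmin]≤f[xs] {f = f} σ₀ σs)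
        (∈-filter⁺ P? (∈-map⁺ finToFun (∈-allFin (funToFin τ)))
          (P-resp (λ j → sym (finToFun-funToFin τ j)) Pτ)))
  }
  where
  all σs : List (Schedule n m)
  all = map finToFun (allFin _)
  σs  = filter P? all

module _ {n m : ℕ} (I : Instance n m) where
  open Instance I

  Feasible : Pred (Schedule n m) 0ℓ
  Feasible σ = ∀ j → σ j ∈ Γ j

  -- The load of machine i when only the jobs in js are counted.
  loadOf : List (Fin n) → Schedule n m → Fin m → ℕ
  loadOf js σ i = sum (map p (filter (λ j → σ j ≟ i) js))

  load : Schedule n m → Fin m → ℕ
  load = loadOf (allFin n)

  -- The default value 0 matters only when m = 0.
  Cmax : Schedule n m → ℕ
  Cmax σ = max 0 (map (load σ) (allFin m))

  move : Schedule n m → Schedule n m → ℕ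
  move σ τ = sum (map p (filter (λ j → ¬? (σ j ≟ τ j)) (allFin n)))

  feasible? : Decidable Feasible
  feasible? σ = all? λ j → σ j ∈? Γ j

  Feasible-resp : Feasible Respects _≗_
  Feasible-resp σ≗τ Fσ j = subst (_∈ Γ j) (σ≗τ j) (Fσ j)

  Cmax-cong : Cmax Preserves _≗_ ⟶ _≡_
  Cmax-cong {σ} {τ} σ≗τ = cong (max 0) (map-cong load-cong (allFin m))
    where
    load-cong : load σ ≗ load τ
    load-cong i = cong (λ js → sum (map p js))
      (filter-≐ (λ j → σ j ≟ i) (λ j → τ j ≟ i)
        ((λ {j} → trans (sym (σ≗τ j))) , (λ {j} → trans (σ≗τ j))) (allFin n))

  move-cong : ∀ π → (λ σ → move σ π) Preserves _≗_ ⟶ _≡_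
  move-cong π {σ} {τ} σ≗τ = cong (λ js → sum (map p js))
    (filter-≐ (λ j → ¬? (σ j ≟ π j)) (λ j → ¬? (τ j ≟ π j))
      ( (λ {j} σ≢π τ≡π → σ≢π (trans (σ≗τ j) τ≡π))
      , (λ {j} τ≢π σ≡π → τ≢π (trans (sym (σ≗τ j)) σ≡π))) (allFin n))

  minimumMakespan : Minimum Feasible Cmax
  minimumMakespan = minimum feasible? Feasible-resp Cmax-cong
    ((λ j → proj₁ (Γ-nonempty j)) , (λ j → proj₂ (Γ-nonempty j)))

  OPT : ℕ
  OPT = Minimum.value minimumMakespan

  Optimal : Pred (Schedule n m) 0ℓ
  Optimal σ = Feasible σ × Cmax σ ≡ OPT

  minimumMove : ∀ π̂ → Minimum Optimal (λ σ → move σ π̂)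
  minimumMove π̂ = minimum
    (λ σ → feasible? σ ×-dec (Cmax σ ≟ℕ OPT))
    (λ σ≗τ (Fσ , eq) → Feasible-resp σ≗τ Fσ , trans (sym (Cmax-cong σ≗τ)) eq)
    (move-cong π̂)
    (Minimum.minimizer minimumMakespan , Minimum.member minimumMakespan , refl)

  predictionError : Schedule n m → ℕ
  predictionError π̂ = Minimum.value (minimumMove π̂)

  -- Project is nondeterministic (processing order and tie-breaking are
  -- arbitrary), so it is given as a relation between π̂ and its outputs σ̂.
  -- Decisions are never revised: when job j is processed, the current load of a
  -- machine is the load σ̂ puts on it from the jobs already done.
  data Step (π̂ σ̂ : Schedule n m) (done : List (Fin n)) (j : Fin n) : Set where
    keep   : π̂ j ∈ Γ j → σ̂ j ≡ π̂ j → Step π̂ σ̂ done j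
    greedy : π̂ j ∉ Γ j → σ̂ j ∈ Γ j →
             (∀ i → i ∈ Γ j → loadOf done σ̂ (σ̂ j) ≤ loadOf done σ̂ i) →
             Step π̂ σ̂ done j

  -- Run π̂ σ̂ done todo: the jobs in todo are processed in list order, starting
  -- once those in done have been assigned.
  data Run (π̂ σ̂ : Schedule n m) (done : List (Fin n)) : List (Fin n) → Set where
    []  : Run π̂ σ̂ done []
    _∷_ : ∀ {j js} → Step π̂ σ̂ done j → Run π̂ σ̂ (done ∷ʳ j) js →
          Run π̂ σ̂ done (j ∷ js)

  record IsProject (π̂ σ̂ : Schedule n m) : Set where
    field
      order         : List (Fin n)
      order-allJobs : order ↭ allFin n
      run           : Run π̂ σ̂ [] order

{-# OPTIONS --safe #-}
-- Let σ* be an optimal schedule closest to π̂. A job on which σ* and π̂ agree has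
-- an eligible prediction, so Project keeps it where σ* puts it. Hence every job
-- on machine i under σ̂ is either on i under σ* or moved between σ* and π̂, and
-- load σ̂ i ≤ load σ* i + move σ* π̂.
module Submission where

open import Defs
open import Data.Fin.Properties using (_≟_)
open import Data.Fin.Subset using () renaming (_∈_ to _∈ˢ_)
open import Data.List.Base using (List; []; _∷_; map; filter; allFin)
open import Data.List.Extrema.Nat using (max≤v⁺; xs≤max)
open import Data.List.Membership.Propositional using (_∈_)
open import Data.List.Membership.Propositional.Properties using (∈-allFin; ∈-map⁺)
open import Data.List.Relation.Binary.Permutation.Propositional using (↭-sym)
open import Data.List.Relation.Binary.Permutation.Propositional.Properties using (∈-resp-↭)
open import Data.List.Relation.Unary.All using (lookup; universal)
open import Data.List.Relation.Unary.All.Properties using (map⁺)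
open import Data.List.Relation.Unary.Any using (here; there)
open import Data.Nat.Base using (ℕ; _+_; _≤_; z≤n)
open import Data.Nat.ListAction using (sum)
open import Data.Nat.Properties
  using (≤-trans; ≤-reflexive; +-monoʳ-≤; +-monoˡ-≤; +-mono-≤; +-assoc; m≤n+m;
         +-commutativeSemigroup; module ≤-Reasoning)
open import Data.Product.Base using (proj₁; proj₂)
open import Data.Sum.Base using (_⊎_; inj₁; inj₂)
open import Algebra.Properties.CommutativeSemigroup +-commutativeSemigroup using (x∙yz≈y∙xz)
open import Level using (Level)
open import Relation.Binary.PropositionalEquality using (_≡_; refl; sym; trans; cong; subst)
open import Relation.Nullary using (yes; no; contradiction; ¬?)
open import Relation.Unary using (Pred; Decidable; _⊆_; _∪_)

private variable
  a ℓ₁ ℓ₂ ℓ₃ : Level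

-- `load` and `move` both unfold to this shape with `w` the processing time, so one inequality
-- serves for both.
weight : ∀ {A : Set a} (w : A → ℕ) {P : Pred A ℓ₁} → Decidable P → List A → ℕ
weight w P? xs = sum (map w (filter P? xs))

-- A union bound: each entry counted on the left is counted at least once on the right, and all
-- other entries can only enlarge the right side. An entry in both `Q` and `R` is counted twice
-- there, hence an inequality.
weight-∪ : ∀ {A : Set a} (w : A → ℕ)
           {P : Pred A ℓ₁} {Q : Pred A ℓ₂} {R : Pred A ℓ₃}
           (P? : Decidable P) (Q? : Decidable Q) (R? : Decidable R) →
           P ⊆ Q ∪ R → ∀ xs →
           weight w P? xs ≤ weight w Q? xs + weight w R? xs
weight-∪ w P? Q? R? P⊆Q∪R [] = z≤n
weight-∪ w P? Q? R? P⊆Q∪R (x ∷ xs)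
  with ih ← weight-∪ w P? Q? R? P⊆Q∪R xs
  with P? x | Q? x | R? x
... | no _  | no _  | no _  = ih
... | no _  | no _  | yes _ = ≤-trans ih (+-monoʳ-≤ (weight w Q? xs) (m≤n+m (weight w R? xs) (w x)))
... | no _  | yes _ | no _  = ≤-trans ih (+-monoˡ-≤ (weight w R? xs) (m≤n+m (weight w Q? xs) (w x)))
... | no _  | yes _ | yes _ = ≤-trans ih (+-mono-≤ (m≤n+m (weight w Q? xs) (w x)) (m≤n+m (weight w R? xs) (w x)))
... | yes _ | yes _ | no _  = ≤-trans (+-monoʳ-≤ (w x) ih) (≤-reflexive (sym (+-assoc (w x) (weight w Q? xs) (weight w R? xs))))
... | yes _ | yes _ | yes _ = ≤-trans (+-monoʳ-≤ (w x) (≤-trans ih (+-monoʳ-≤ (weight w Q? xs) (m≤n+m (weight w R? xs) (w x)))))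
                                      (≤-reflexive (sym (+-assoc (w x) (weight w Q? xs) (w x + (weight w R? xs)))))
... | yes _ | no _  | yes _ = ≤-trans (+-monoʳ-≤ (w x) ih) (≤-reflexive (x∙yz≈y∙xz (w x) (weight w Q? xs) (weight w R? xs)))
-- The only case in which the left side alone would grow; the inclusion excludes it.
... | yes Px | no ¬Qx | no ¬Rx with P⊆Q∪R Px
...   | inj₁ Qx = contradiction Qx ¬Qx
...   | inj₂ Rx = contradiction Rx ¬Rx

module _ {n m : ℕ} (I : Instance n m) where
  open Instance I

  load≤Cmax : ∀ σ i → load I σ i ≤ Cmax I σ
  load≤Cmax σ i = lookup (xs≤max 0 (map (load I σ) (allFin m))) (∈-map⁺ (load I σ) (∈-allFin i))

  Cmax≤ : ∀ σ {b} → (∀ i → load I σ i ≤ b) → Cmax I σ ≤ b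
  -- `z≤n` bounds the default value 0 of `max`.
  Cmax≤ σ load≤b = max≤v⁺ z≤n (map⁺ (universal load≤b (allFin m)))

  -- The whole of `move` is charged to the single machine `i`. A job that reaches `i` only under
  -- `σ̂` cannot have `σ` and `π̂` agreeing on it, so it is already paid for by the distance from
  -- `σ` to `π̂`.
  load≤load+move : ∀ {σ̂ σ π̂ : Schedule n m} → (∀ j → σ j ≡ π̂ j → σ̂ j ≡ σ j) →
                   ∀ i → load I σ̂ i ≤ load I σ i + move I σ π̂
  load≤load+move {σ̂} {σ} {π̂} agree i =
    weight-∪ p (λ j → σ̂ j ≟ i) (λ j → σ j ≟ i) (λ j → ¬? (σ j ≟ π̂ j)) split (allFin n)
    where
    split : ∀ {j} → σ̂ j ≡ i → σ j ≡ i ⊎ _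
    split {j} σ̂j≡i with σ j ≟ π̂ j
    ... | yes σj≡π̂j = inj₁ (trans (sym (agree j σj≡π̂j)) σ̂j≡i)
    ... | no  σj≢π̂j = inj₂ σj≢π̂j

  module _ {π̂ σ̂ : Schedule n m} where

    Step-keeps : ∀ {done j} → Step I π̂ σ̂ done j → π̂ j ∈ˢ Γ j → σ̂ j ≡ π̂ j
    Step-keeps (keep _ σ̂j≡π̂j)  _    = σ̂j≡π̂j
    Step-keeps (greedy π̂j∉Γ _ _) π̂j∈Γ = contradiction π̂j∈Γ π̂j∉Γ

    -- Stated for an arbitrary `done`, since that list grows with each step of the induction.
    Run-keeps : ∀ {done js j} → Run I π̂ σ̂ done js → j ∈ js → π̂ j ∈ˢ Γ j → σ̂ j ≡ π̂ j
    Run-keeps (step ∷ _)  (here refl)  = Step-keeps step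
    Run-keeps (_ ∷ run)   (there j∈js) = Run-keeps run j∈js

    IsProject-keeps : IsProject I π̂ σ̂ → ∀ j → π̂ j ∈ˢ Γ j → σ̂ j ≡ π̂ j
    IsProject-keeps proj j = Run-keeps run (∈-resp-↭ (↭-sym order-allJobs) (∈-allFin j))
      where open IsProject proj

theorem5 : ∀ {n m : ℕ} (I : Instance n m) (π̂ σ̂ : Schedule n m) →
    IsProject I π̂ σ̂ → Cmax I σ̂ ≤ OPT I + predictionError I π̂
theorem5 I π̂ σ̂ proj = Cmax≤ I σ̂ λ i → begin
  load I σ̂ i                    ≤⟨ load≤load+move I agree i ⟩
  load I σ* i + move I σ* π̂     ≤⟨ +-monoˡ-≤ _ (load≤Cmax I σ* i) ⟩
  -- `predictionError` is by definition the move of `σ*`, so only the makespan is rewritten, by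
  -- optimality of `σ*`.
  Cmax I σ* + move I σ* π̂       ≡⟨ cong (_+ move I σ* π̂) (proj₂ member) ⟩
  OPT I + predictionError I π̂   ∎
  where
  open ≤-Reasoning
  open Instance I
  open Minimum (minimumMove I π̂) renaming (minimizer to σ*)

  agree : ∀ j → σ* j ≡ π̂ j → σ̂ j ≡ σ* j
  agree j σ*j≡π̂j = trans
    -- Feasibility of `σ*` makes the shared machine eligible for `j`, which is what forces `Project`
    -- to keep the prediction.
    (IsProject-keeps I proj j (subst (_∈ˢ Γ j) σ*j≡π̂j (proj₁ member j)))
    (sym σ*j≡π̂j)
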